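{- Let $n,s,t,k$ be positive integers with $k\geq \binom{s}{2}$, and let $c_1,c_2,\ldots,c_k$ be all the $k$ colors. If, for some $p_1,p_2,\ldots,p_k$ with $0\leq p_i\leq 1$ $(1\leq i\leq k)$, $$\binom{n}{s}\left[\left(\frac{s(s-1)}{2}\right)!\right]\sum_{\{x_1,x_2,\ldots,x_{\binom{s}{2}}\}\subseteq \{1,2,\ldots,k\}}p_{x_1}p_{x_2}\cdots p_{x_{\binom{s}{2}}}+\binom{n}{t}\sum_{x_i\in\{1,2,\ldots,k\}}p_{x_i}^{\binom{t}{2}}<1,$$ where the first sum runs over all subsets of $\{1,2,\ldots,k\}$ with exactly $\binom{s}{2}$ elements and the second sum runs over all elements of $\{1,2,\ldots,k\}$, then $\operatorname{gr}_k(s,t)>n$.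
   Context: A $k$-edge-coloring of $K_n$ assigns to each edge one of the $k$ colors $c_1,\ldots,c_k$ (not all colors need be used, and it need not be proper). A subgraph is rainbow if all its edges have distinct colors, and monochromatic if all its edges have the same color. The Gallai-Ramsey function $\operatorname{gr}_k(s,t)$ is the minimum integer $n$ such that every $k$-edge-coloring of the complete graph $K_n$ contains a rainbow copy of $K_s$ or a monochromatic copy of $K_t$.
   Formalization: The formal theorem adds the condition p_1+...+p_k = 1; without it the claim is false (k=1, s=t=n=2, p_1=0 gives 0<1 but gr_1(2,2)=2). The case of a sum above 1 reduces to it by scaling. -}

module Defs where

open import Algebra.Apartness.Bundles using (HeytingCommutativeRing; HeytingField)
open import Algebra.Bundles using (CommutativeRing; Semiring)
import Algebra.Definitions.RawSemiring as SemiringDefinitions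
open import Data.Bool.Base using (if_then_else_)
open import Data.Fin.Base using (Fin) renaming (_<_ to _<ᶠ_)
open import Data.Fin.Subset using (Subset; inside; outside; ∣_∣; _∈_)
open import Data.List.Base using (List; []; _∷_; _++_; map; filter; foldr)
open import Data.Nat.Base as ℕ using (ℕ; zero; suc)
import Data.Nat.Properties as ℕₚ
open import Data.Product.Base using (∃; _×_)
open import Data.Rational.Base as ℚ using (ℚ)
import Data.Rational.Properties as ℚₚ
open import Data.Sum.Base using (_⊎_; inj₁; inj₂; [_,_]′)
open import Data.Vec.Base as Vec using (lookup)
open import Function.Bundles using (_⇔_; mk⇔)
open import Level using (0ℓ; _⊔_) renaming (suc to lsuc)
open import Relation.Binary.Core using (Rel)
open import Relation.Binary.Definitions using (tri<; tri≈; tri>)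
open import Relation.Binary.PropositionalEquality using (_≡_; _≢_; sym)
open import Relation.Binary.Structures using (IsStrictPartialOrder)
open import Relation.Nullary.Negation using (¬_; contradiction)

-- The library has no real numbers, so weights are taken in an arbitrary
-- ordered field.  The order is not assumed decidable or total, so the
-- axioms hold for the usual constructive reals as well as for ℚ;
-- nontriviality (0# # 1#) follows from the Heyting field axioms.

record OrderedField c ℓ₁ ℓ₂ ℓ₃ : Set (lsuc (c ⊔ ℓ₁ ⊔ ℓ₂ ⊔ ℓ₃)) where
  infix 4 _<_ _≤_
  field
    heytingField : HeytingField c ℓ₁ ℓ₂

  open HeytingField heytingField public

  field
    _<_                    : Rel Carrier ℓ₃
    <-isStrictPartialOrder : IsStrictPartialOrder _≈_ _<_
    #⇔<⊎>                  : ∀ x y → (x # y) ⇔ (x < y ⊎ y < x)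
    +-monoˡ-<              : ∀ z {x y} → x < y → (x + z) < (y + z)
    *-pos                  : ∀ {x y} → 0# < x → 0# < y → 0# < (x * y)

  -- The constructive definition of ≤; for a total order it is
  -- equivalent to x < y ⊎ x ≈ y.
  _≤_ : Rel Carrier ℓ₃
  x ≤ y = ¬ (y < x)

  open HeytingCommutativeRing heytingCommutativeRing public
    using (commutativeRing)
  open CommutativeRing commutativeRing public using (semiring)
  open Semiring semiring public using (rawSemiring)

ℚ-orderedField : OrderedField 0ℓ 0ℓ 0ℓ 0ℓ
ℚ-orderedField = record
  { heytingField           = ℚₚ.heytingField
  ; _<_                    = ℚ._<_
  ; <-isStrictPartialOrder = ℚₚ.<-isStrictPartialOrder
  ; #⇔<⊎>                  = λ x y → mk⇔ (to x y)
      [ (λ x<y x≡y → ℚₚ.<-irrefl x≡y x<y)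
      , (λ y<x x≡y → ℚₚ.<-irrefl (sym x≡y) y<x) ]′
  ; +-monoˡ-<              = ℚₚ.+-monoˡ-<
  ; *-pos                  = *-pos
  }
  where
  to : ∀ x y → x ≢ y → x ℚ.< y ⊎ y ℚ.< x
  to x y x≢y with ℚₚ.<-cmp x y
  ... | tri< x<y _ _ = inj₁ x<y
  ... | tri≈ _ x≡y _ = contradiction x≡y x≢y
  ... | tri> _ _ y<x = inj₂ y<x

  *-pos : ∀ {x y} → ℚ.0ℚ ℚ.< x → ℚ.0ℚ ℚ.< y → ℚ.0ℚ ℚ.< x ℚ.* y
  *-pos {x} {y} 0<x 0<y = ℚₚ.positive⁻¹ (x ℚ.* y)
    {{ℚₚ.pos*pos⇒pos x {{ℚ.positive 0<x}} y {{ℚ.positive 0<y}}}}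

allSubsets : ∀ k → List (Subset k)
allSubsets zero    = Vec.[] ∷ []
allSubsets (suc k) =
  map (outside Vec.∷_) (allSubsets k) ++ map (inside Vec.∷_) (allSubsets k)

subsetsOfSize : ∀ k → ℕ → List (Subset k)
subsetsOfSize k r = filter (λ S → ∣ S ∣ ℕₚ.≟ r) (allSubsets k)

module Sums {c ℓ₁ ℓ₂ ℓ₃} (F : OrderedField c ℓ₁ ℓ₂ ℓ₃) where
  open OrderedField F
  open SemiringDefinitions rawSemiring public using (_×_; _^_; sum; product)

  subsetProduct : ∀ {k} → (Fin k → Carrier) → Subset k → Carrier
  subsetProduct p S = product (λ x → if lookup S x then p x else 1#)

  subsetProductSum : ∀ {k} → ℕ → (Fin k → Carrier) → Carrier
  subsetProductSum {k} r p =
    foldr _+_ 0# (map (subsetProduct p) (subsetsOfSize k r))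

-- The edge {u , v} of K_n is stored with its smaller endpoint first; the
-- ordering proof is irrelevant, so edges are equal exactly when their
-- endpoints are.
record Edge (n : ℕ) : Set where
  constructor edge
  field
    u    : Fin n
    v    : Fin n
    .u<v : u <ᶠ v

EdgeColouring : ℕ → ℕ → Set
EdgeColouring k n = Edge n → Fin k

_within_ : ∀ {n} → Edge n → Subset n → Set
e within S = Edge.u e ∈ S × Edge.v e ∈ S

-- A copy of K_s in K_n is determined by its vertex set, so copies are
-- represented by s-element subsets.

Rainbow : ∀ {k n} → EdgeColouring k n → Subset n → Set
Rainbow χ S = ∀ e e′ → e within S → e′ within S → e ≢ e′ → χ e ≢ χ e′

Monochromatic : ∀ {k n} → EdgeColouring k n → Subset n → Set
Monochromatic χ S = ∀ e e′ → e within S → e′ within S → χ e ≡ χ e′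

ContainsRainbow : ∀ {k n} → EdgeColouring k n → ℕ → Set
ContainsRainbow χ s = ∃ λ S → ∣ S ∣ ≡ s × Rainbow χ S

ContainsMonochromatic : ∀ {k n} → EdgeColouring k n → ℕ → Set
ContainsMonochromatic χ t = ∃ λ S → ∣ S ∣ ≡ t × Monochromatic χ S

Unavoidable : (k s t n : ℕ) → Set
Unavoidable k s t n =
  (χ : EdgeColouring k n) → ContainsRainbow χ s ⊎ ContainsMonochromatic χ t

-- g is the value gr_k(s,t); at most one g qualifies, and Ramsey's theorem
-- guarantees that one exists.
record IsGallaiRamseyNumber (k s t g : ℕ) : Set where
  field
    unavoidable : Unavoidable k s t g
    least       : ∀ n → Unavoidable k s t n → g ℕ.≤ n

{-# OPTIONS --safe #-}

-- First moment method.  Colour the edges of K_n independently, giving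
-- colour i with probability p i.  A fixed K_t is monochromatic with
-- probability at most ∑ p_i^(t C 2), and a fixed K_s is rainbow with
-- probability r! e_r(p), where r = s C 2 and e_r is the r-th elementary
-- symmetric polynomial; the latter follows by revealing the edges one at a
-- time from Euler's identity ∑ q_i e_r(q with q_i := 0) = (r+1) e_{r+1}(q).
-- If every colouring contained one or the other, the union bound would give
-- 1 ≤ (n C s) r! e_r(p) + (n C t) ∑ p_i^(t C 2).
module Submission where

open import Algebra.Bundles using (CommutativeRing)
import Algebra.Properties.CommutativeMonoid.Mult
import Algebra.Properties.CommutativeSemigroup
import Algebra.Properties.Ring
import Algebra.Properties.Semiring.Exp
import Algebra.Properties.Semiring.Mult
import Algebra.Properties.Semiring.Sum
open import Data.Bool.Base using (true; false; if_then_else_)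
open import Data.Fin.Base using (Fin; zero; suc; splitAt; _↑ˡ_; _↑ʳ_; fromℕ<)
open import Data.Fin.Properties using (splitAt⁻¹-↑ˡ; splitAt⁻¹-↑ʳ)
open import Data.Fin.Subset using (Subset; inside; outside; ∣_∣; _∈_; ⊥)
open import Data.Fin.Subset.Properties using (∉⊥; ∣⊥∣≡0; nonempty?)
open import Data.List.Base using (List; []; _∷_; _++_; map; filter; foldr; length)
open import Data.List.Membership.Propositional using () renaming (_∈_ to _∈ᴸ_)
open import Data.List.Membership.Propositional.Properties
  using (∈-++⁺ˡ; ∈-++⁺ʳ; ∈-map⁺; ∈-filter⁺; ∈-filter⁻)
open import Data.List.Properties
  using (filter-++; filter-≐; filter-none; length-++; length-map; ++-identityʳ)
import Data.List.Relation.Unary.All as All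
open import Data.List.Relation.Unary.Any using (here; there)
open import Data.Nat.Base as ℕ using (ℕ; zero; suc; z<s; s<s⁻¹; _≤′_; ≤′-reflexive; ≤′-step; _!)
open import Data.Nat.Combinatorics using (_C_; nC1≡n; nCk+nC[k+1]≡[n+1]C[k+1])
open import Data.Nat.DivMod using (_/_; m*n/n≡m)
import Data.Nat.Properties as ℕₚ
open import Data.Nat.Tactic.RingSolver using (solve-∀)
open import Data.Product.Base using (∃; _,_; proj₁; proj₂)
open import Data.Sum.Base as Sum using (inj₁; inj₂; [_,_]′)
open import Data.Vec.Base as Vec using (Vec; lookup)
open import Data.Vec.Functional using (Vector; head; tail; updateAt)
open import Data.Vec.Functional.Properties using (updateAt-updates; updateAt-minimal)
open import Data.Vec.Properties using ([]=⇒lookup; lookup⇒[]=; lookup-++ˡ; lookup-++ʳ)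
open import Function.Base using (_∘_; const)
open import Function.Bundles using (Equivalence)
open import Relation.Binary.PropositionalEquality as ≡
  using (_≡_; _≢_; module ≡-Reasoning)
import Relation.Binary.Reasoning.Setoid
open import Relation.Binary.Structures using (IsStrictPartialOrder)
open import Relation.Nullary.Decidable using (does; yes; no)
open import Relation.Nullary.Negation using (contradiction)
open import Relation.Unary using (Pred; Decidable)
open import Defs

-- Enumerating subsets of a given size.

filter-map : ∀ {a b p} {A : Set a} {B : Set b} {P : Pred B p} (P? : Decidable P)
             (f : A → B) xs → filter P? (map f xs) ≡ map f (filter (P? ∘ f) xs)
filter-map P? f []       = ≡.refl
filter-map P? f (x ∷ xs) with does (P? (f x))
... | true  = ≡.cong (f x ∷_) (filter-map P? f xs)
... | false = filter-map P? f xs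

-- The second filter keeps the test `suc ∣ S ∣ ≟ r`: it is empty for `r = 0` and drops to the
-- predecessor otherwise, which are the next two lemmas.
subsetsOfSize-split : ∀ k r → subsetsOfSize (suc k) r ≡
  map (outside Vec.∷_) (subsetsOfSize k r) ++
  map (inside Vec.∷_) (filter (λ S → suc ∣ S ∣ ℕₚ.≟ r) (allSubsets k))
subsetsOfSize-split k r = ≡.trans
  (filter-++ (λ S → ∣ S ∣ ℕₚ.≟ r) (map (outside Vec.∷_) (allSubsets k)) _)
  (≡.cong₂ _++_ (filter-map _ _ (allSubsets k)) (filter-map _ _ (allSubsets k)))

subsetsOfSize-zero : ∀ k →
  subsetsOfSize (suc k) 0 ≡ map (outside Vec.∷_) (subsetsOfSize k 0)
subsetsOfSize-zero k = ≡.trans (subsetsOfSize-split k 0) (≡.trans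
  (≡.cong (λ Ss → map (outside Vec.∷_) (subsetsOfSize k 0) ++ map (inside Vec.∷_) Ss)
    (filter-none (λ S → suc ∣ S ∣ ℕₚ.≟ 0) (All.universal (λ _ ()) (allSubsets k))))
  (++-identityʳ _))

subsetsOfSize-suc : ∀ k r → subsetsOfSize (suc k) (suc r) ≡
  map (outside Vec.∷_) (subsetsOfSize k (suc r)) ++
  map (inside Vec.∷_) (subsetsOfSize k r)
subsetsOfSize-suc k r = ≡.trans (subsetsOfSize-split k (suc r))
  (≡.cong (λ Ss → map (outside Vec.∷_) (subsetsOfSize k (suc r)) ++ map (inside Vec.∷_) Ss)
    (filter-≐ _ _ (ℕₚ.suc-injective , ≡.cong suc) (allSubsets k)))

-- Pascal's rule, splitting the subsets by whether they contain the first element.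
length-subsetsOfSize : ∀ k r → length (subsetsOfSize k r) ≡ k C r
length-subsetsOfSize zero    zero    = ≡.refl
length-subsetsOfSize zero    (suc r) = ≡.refl
length-subsetsOfSize (suc k) zero    = begin
  length (subsetsOfSize (suc k) 0)                     ≡⟨ ≡.cong length (subsetsOfSize-zero k) ⟩
  length (map (outside Vec.∷_) (subsetsOfSize k 0))    ≡⟨ length-map _ (subsetsOfSize k 0) ⟩
  length (subsetsOfSize k 0)                           ≡⟨ length-subsetsOfSize k 0 ⟩
  1                                                    ∎
  where open ≡-Reasoning
length-subsetsOfSize (suc k) (suc r) = begin
  length (subsetsOfSize (suc k) (suc r))
    ≡⟨ ≡.cong length (subsetsOfSize-suc k r) ⟩
  length (map (outside Vec.∷_) (subsetsOfSize k (suc r)) ++ map (inside Vec.∷_) (subsetsOfSize k r))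
    ≡⟨ length-++ (map (outside Vec.∷_) (subsetsOfSize k (suc r))) ⟩
  length (map (outside Vec.∷_) (subsetsOfSize k (suc r))) ℕ.+
  length (map (inside Vec.∷_) (subsetsOfSize k r))
    ≡⟨ ≡.cong₂ ℕ._+_ (length-map _ (subsetsOfSize k (suc r))) (length-map _ (subsetsOfSize k r)) ⟩
  length (subsetsOfSize k (suc r)) ℕ.+ length (subsetsOfSize k r)
    ≡⟨ ≡.cong₂ ℕ._+_ (length-subsetsOfSize k (suc r)) (length-subsetsOfSize k r) ⟩
  k C suc r ℕ.+ k C r
    ≡⟨ ℕₚ.+-comm (k C suc r) (k C r) ⟩
  k C r ℕ.+ k C suc r
    ≡⟨ nCk+nC[k+1]≡[n+1]C[k+1] k r ⟩
  suc k C suc r ∎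
  where open ≡-Reasoning

∈-allSubsets : ∀ {k} (S : Subset k) → S ∈ᴸ allSubsets k
∈-allSubsets Vec.[]            = here ≡.refl
∈-allSubsets (outside Vec.∷ S) = ∈-++⁺ˡ (∈-map⁺ _ (∈-allSubsets S))
∈-allSubsets (inside  Vec.∷ S) = ∈-++⁺ʳ _ (∈-map⁺ _ (∈-allSubsets S))

∈-subsetsOfSize : ∀ {k r} (S : Subset k) → ∣ S ∣ ≡ r → S ∈ᴸ subsetsOfSize k r
∈-subsetsOfSize {r = r} S = ∈-filter⁺ (λ S → ∣ S ∣ ℕₚ.≟ r) (∈-allSubsets S)

∈-subsetsOfSize⁻ : ∀ {k r} {S : Subset k} → S ∈ᴸ subsetsOfSize k r → ∣ S ∣ ≡ r
∈-subsetsOfSize⁻ {k} {r} = proj₂ ∘ ∈-filter⁻ (λ S → ∣ S ∣ ℕₚ.≟ r) {xs = allSubsets k}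

-- Triangular numbers.

[1+n]C2≡n+nC2 : ∀ n → suc n C 2 ≡ n ℕ.+ n C 2
[1+n]C2≡n+nC2 n = ≡.trans (≡.sym (nCk+nC[k+1]≡[n+1]C[k+1] n 1))
                          (≡.cong (ℕ._+ n C 2) (nC1≡n n))

-- Division is cleared so that induction can use (n+1)n = 2n + n(n-1). The case 1 is separate so
-- that `n ∸ 1` reduces to `m` afterwards.
n*[n∸1]≡nC2*2 : ∀ n → n ℕ.* (n ℕ.∸ 1) ≡ (n C 2) ℕ.* 2
n*[n∸1]≡nC2*2 zero          = ≡.refl
n*[n∸1]≡nC2*2 (suc zero)    = ≡.refl
n*[n∸1]≡nC2*2 (suc n@(suc m)) = begin
  suc n ℕ.* n                ≡⟨ lemma m ⟩
  n ℕ.* 2 ℕ.+ n ℕ.* m        ≡⟨ ≡.cong (n ℕ.* 2 ℕ.+_) (n*[n∸1]≡nC2*2 n) ⟩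
  n ℕ.* 2 ℕ.+ (n C 2) ℕ.* 2    ≡⟨ ℕₚ.*-distribʳ-+ 2 n (n C 2) ⟨
  (n ℕ.+ n C 2) ℕ.* 2        ≡⟨ ≡.cong (ℕ._* 2) ([1+n]C2≡n+nC2 n) ⟨
  (suc n C 2) ℕ.* 2           ∎
  where
  open ≡-Reasoning
  lemma : ∀ m → suc (suc m) ℕ.* suc m ≡ suc m ℕ.* 2 ℕ.+ suc m ℕ.* m
  lemma = solve-∀

-- Links the quotient under the factorial in the theorem with the edge count `s C 2`.
n*[n∸1]/2≡nC2 : ∀ n → n ℕ.* (n ℕ.∸ 1) / 2 ≡ n C 2
n*[n∸1]/2≡nC2 n = ≡.trans (≡.cong (_/ 2) (n*[n∸1]≡nC2*2 n)) (m*n/n≡m (n C 2) 2)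

-- Edges of the complete graph as positions in a list.

∣p++q∣≡∣p∣+∣q∣ : ∀ {m n} (p : Subset m) (q : Subset n) → ∣ p Vec.++ q ∣ ≡ ∣ p ∣ ℕ.+ ∣ q ∣
∣p++q∣≡∣p∣+∣q∣ Vec.[]            q = ≡.refl
∣p++q∣≡∣p∣+∣q∣ (outside Vec.∷ p) q = ∣p++q∣≡∣p∣+∣q∣ p q
∣p++q∣≡∣p∣+∣q∣ (inside  Vec.∷ p) q = ≡.cong suc (∣p++q∣≡∣p∣+∣q∣ p q)

-- The edges of K_{n+1} are enumerated with the n edges at vertex 0 first.

edgeCount : ℕ → ℕ
edgeCount zero    = 0
edgeCount (suc n) = n ℕ.+ edgeCount n

position : ∀ {n} → Edge n → Fin (edgeCount n)
position {suc n} (edge zero    (suc j) _)   = j ↑ˡ edgeCount n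
position {suc n} (edge (suc i) (suc j) i<j) = n ↑ʳ position (edge i j (s<s⁻¹ i<j))

shift : ∀ {n} → Edge n → Edge (suc n)
shift (edge i j i<j) = edge (suc i) (suc j) (ℕ.s<s i<j)

edgeAt : ∀ n → Fin (edgeCount n) → Edge n
edgeAt (suc n) l =
  [ (λ j → edge zero (suc j) z<s) , shift ∘ edgeAt n ]′ (splitAt n l)

-- Since `edgeAt n` is a section of `position`, distinct positions decode to distinct edges, and a
-- colouring read through `position` has entry `l` at `edgeAt n l`.
position-edgeAt : ∀ n l → position (edgeAt n l) ≡ l
position-edgeAt (suc n) l with splitAt n l in eq
... | inj₁ j = splitAt⁻¹-↑ˡ eq
... | inj₂ m = ≡.trans (≡.cong (n ↑ʳ_) (position-edgeAt n m)) (splitAt⁻¹-↑ʳ eq)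

-- The blocks match `edgeCount`. The first has one bit per edge at vertex 0, indexed by the other
-- endpoint: it is the rest of the vertex set if 0 belongs to it, and empty otherwise.
edgesWithin : ∀ {n} → Subset n → Subset (edgeCount n)
edgesWithin Vec.[]      = Vec.[]
edgesWithin (x Vec.∷ S) = (if x then S else ⊥) Vec.++ edgesWithin S

∣edgesWithin∣ : ∀ {n} (S : Subset n) → ∣ edgesWithin S ∣ ≡ ∣ S ∣ C 2
∣edgesWithin∣ Vec.[] = ≡.refl
∣edgesWithin∣ {suc n} (outside Vec.∷ S) = begin
  ∣ ⊥ {n} Vec.++ edgesWithin S ∣   ≡⟨ ∣p++q∣≡∣p∣+∣q∣ (⊥ {n}) (edgesWithin S) ⟩
  ∣ ⊥ {n} ∣ ℕ.+ ∣ edgesWithin S ∣  ≡⟨ ≡.cong₂ ℕ._+_ (∣⊥∣≡0 n) (∣edgesWithin∣ S) ⟩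
  ∣ S ∣ C 2                        ∎
  where open ≡-Reasoning
∣edgesWithin∣ (inside Vec.∷ S) = begin
  ∣ S Vec.++ edgesWithin S ∣       ≡⟨ ∣p++q∣≡∣p∣+∣q∣ S (edgesWithin S) ⟩
  ∣ S ∣ ℕ.+ ∣ edgesWithin S ∣      ≡⟨ ≡.cong (∣ S ∣ ℕ.+_) (∣edgesWithin∣ S) ⟩
  ∣ S ∣ ℕ.+ ∣ S ∣ C 2              ≡⟨ [1+n]C2≡n+nC2 ∣ S ∣ ⟨
  suc ∣ S ∣ C 2                    ∎
  where open ≡-Reasoning

∈-++⁻ˡ : ∀ {m n} (p : Subset m) (q : Subset n) {i} → i ↑ˡ n ∈ p Vec.++ q → i ∈ p
∈-++⁻ˡ p q {i} i∈ = lookup⇒[]= i p (≡.trans (≡.sym (lookup-++ˡ p q i)) ([]=⇒lookup i∈))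

∈-++⁻ʳ : ∀ {m n} (p : Subset m) (q : Subset n) {i} → m ↑ʳ i ∈ p Vec.++ q → i ∈ q
∈-++⁻ʳ p q {i} i∈ = lookup⇒[]= i q (≡.trans (≡.sym (lookup-++ʳ p q i)) ([]=⇒lookup i∈))

∈-edgesWithin : ∀ {n} (S : Subset n) {l} → l ∈ edgesWithin S → edgeAt n l within S
∈-edgesWithin {suc n} (x Vec.∷ S) {l} l∈ with splitAt n l in eq
-- Replacing `l` by its image under the block embedding lets membership in the concatenation be
-- projected to that block.
... | inj₂ m rewrite ≡.sym (splitAt⁻¹-↑ʳ eq) =
  let i∈S , j∈S = ∈-edgesWithin S (∈-++⁻ʳ (if x then S else ⊥) (edgesWithin S) l∈)
  in Vec.there i∈S , Vec.there j∈S
... | inj₁ j rewrite ≡.sym (splitAt⁻¹-↑ˡ eq) with x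
...   | inside  = Vec.here , Vec.there (∈-++⁻ˡ S (edgesWithin S) l∈)
...   | outside = contradiction (∈-++⁻ˡ ⊥ (edgesWithin S) l∈) ∉⊥

-- Colourings as vectors, over which sums can be taken by recursion.

colouring : ∀ {k} n → Vec (Fin k) (edgeCount n) → EdgeColouring k n
colouring _ v e = lookup v (position e)

colouring-edgeAt : ∀ {k n} (v : Vec (Fin k) (edgeCount n)) l →
                   colouring n v (edgeAt n l) ≡ lookup v l
colouring-edgeAt {n = n} v l = ≡.cong (lookup v) (position-edgeAt n l)

InjectiveOn : ∀ {k m} → Vec (Fin k) m → Subset m → Set
InjectiveOn v D = ∀ i j → i ∈ D → j ∈ D → i ≢ j → lookup v i ≢ lookup v j

-- Applying `position` to an equality of decoded edges recovers an equality of positions, so `i ≢ j`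
-- gives two distinct edges.
rainbow⇒injectiveOn : ∀ {k n} (v : Vec (Fin k) (edgeCount n)) (S : Subset n) →
                      Rainbow (colouring n v) S → InjectiveOn v (edgesWithin S)
rainbow⇒injectiveOn {n = n} v S rainbow i j i∈ j∈ i≢j vi≡vj =
  rainbow (edgeAt n i) (edgeAt n j) (∈-edgesWithin S i∈) (∈-edgesWithin S j∈)
    (λ eq → i≢j (≡.trans (≡.sym (position-edgeAt n i))
                (≡.trans (≡.cong position eq) (position-edgeAt n j))))
    (≡.trans (colouring-edgeAt {n = n} v i) (≡.trans vi≡vj (≡.sym (colouring-edgeAt {n = n} v j))))

-- k > 0 is needed because S may span no edge.
monochromatic⇒constantOn : ∀ {k n} → k ℕ.> 0 →
  (v : Vec (Fin k) (edgeCount n)) (S : Subset n) → Monochromatic (colouring n v) S →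
  ∃ λ c → ∀ i → i ∈ edgesWithin S → lookup v i ≡ c
monochromatic⇒constantOn {n = n} k>0 v S mono with nonempty? (edgesWithin S)
... | no  empty    = fromℕ< k>0 , λ i i∈ → contradiction (i , i∈) empty
... | yes (j , j∈) = lookup v j , λ i i∈ →
  ≡.trans (≡.sym (colouring-edgeAt {n = n} v i))
  (≡.trans (mono (edgeAt n i) (edgeAt n j) (∈-edgesWithin S i∈) (∈-edgesWithin S j∈))
           (colouring-edgeAt {n = n} v j))

-- Monotonicity of `Unavoidable` in the number of vertices.

Unavoidable-suc : ∀ {k s t n} → Unavoidable k s t n → Unavoidable k s t (suc n)
Unavoidable-suc {k} {n = n} unavoidable χ =
  Sum.map (λ (S , size , rainbow) → outside Vec.∷ S , size , rainbow⁺ S rainbow)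
          (λ (S , size , mono)    → outside Vec.∷ S , size , mono⁺ S mono)
          -- `χ ∘ shift` is the restriction of `χ` to the vertices other than 0. The copy found
          -- there is kept, with 0 left outside.
          (unavoidable (χ ∘ shift))
  where
  rainbow⁺ : ∀ S → Rainbow (χ ∘ shift) S → Rainbow χ (outside Vec.∷ S)
  rainbow⁺ S rainbow (edge _ _ i<j) (edge _ _ i′<j′)
    -- As 0 is outside, both endpoints of each edge are successors, so each edge is a shifted one.
    (Vec.there i∈ , Vec.there j∈) (Vec.there i′∈ , Vec.there j′∈) e≢e′ =
    rainbow (edge _ _ (s<s⁻¹ i<j)) (edge _ _ (s<s⁻¹ i′<j′)) (i∈ , j∈) (i′∈ , j′∈)
      (e≢e′ ∘ ≡.cong shift)

  mono⁺ : ∀ S → Monochromatic (χ ∘ shift) S → Monochromatic χ (outside Vec.∷ S)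
  mono⁺ S mono (edge _ _ i<j) (edge _ _ i′<j′)
    (Vec.there i∈ , Vec.there j∈) (Vec.there i′∈ , Vec.there j′∈) =
    mono (edge _ _ (s<s⁻¹ i<j)) (edge _ _ (s<s⁻¹ i′<j′)) (i∈ , j∈) (i′∈ , j′∈)

-- The order `_≤′_` grows on the right, so each `≤′-step` adds one vertex.
Unavoidable-mono : ∀ {k s t g n} → g ≤′ n → Unavoidable k s t g → Unavoidable k s t n
Unavoidable-mono (≤′-reflexive ≡.refl) unavoidable = unavoidable
Unavoidable-mono {s = s} {t} (≤′-step g≤n) unavoidable =
  Unavoidable-suc {s = s} {t} (Unavoidable-mono {s = s} {t} g≤n unavoidable)

-- Constructive order in an ordered field.

module OrderedFieldProperties {c ℓ₁ ℓ₂ ℓ₃} (F : OrderedField c ℓ₁ ℓ₂ ℓ₃) where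
  open OrderedField F hiding (zero)
  open IsStrictPartialOrder <-isStrictPartialOrder
    using (<-respʳ-≈; <-respˡ-≈; irrefl; asym) renaming (trans to <-trans)

  <⇒# : ∀ {x y} → x < y → x # y
  <⇒# {x} {y} x<y = Equivalence.from (#⇔<⊎> x y) (inj₁ x<y)

  -- With both strict inequalities excluded, `x` and `y` are not apart, and apartness is tight.
  ≤-antisym : ∀ {x y} → x ≤ y → y ≤ x → x ≈ y
  ≤-antisym {x} {y} x≤y y≤x =
    proj₁ (tight x y) ([ y≤x , x≤y ]′ ∘ Equivalence.to (#⇔<⊎> x y))

  ≤-reflexive : ∀ {x y} → x ≈ y → x ≤ y
  ≤-reflexive x≈y y<x = irrefl (sym x≈y) y<x

  -- Cotransitivity of apartness replaces trichotomy: if `z < x`, then `y` is apart from `z` or from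
  -- `x`, and each of the four resulting orders contradicts a hypothesis.
  ≤-trans : ∀ {x y z} → x ≤ y → y ≤ z → x ≤ z
  ≤-trans {x} {y} {z} x≤y y≤z z<x with #-cotrans (<⇒# z<x) y
  ... | inj₁ z#y with Equivalence.to (#⇔<⊎> z y) z#y
  ...   | inj₁ z<y = y≤z z<y
  ...   | inj₂ y<z = x≤y (<-trans y<z z<x)
  ≤-trans {x} {y} {z} x≤y y≤z z<x | inj₂ y#x with Equivalence.to (#⇔<⊎> y x) y#x
  ...   | inj₁ y<x = x≤y y<x
  ...   | inj₂ x<y = y≤z (<-trans z<x x<y)

  +-monoˡ-≤ : ∀ z {x y} → x ≤ y → x + z ≤ y + z
  +-monoˡ-≤ z {x} {y} x≤y y+z<x+z =
    x≤y (<-respˡ-≈ (cancel y) (<-respʳ-≈ (cancel x) (+-monoˡ-< (- z) y+z<x+z)))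
    where
    cancel : ∀ w → w + z + - z ≈ w
    cancel w = trans (+-assoc w z (- z)) (trans (+-congˡ (-‿inverseʳ z)) (+-identityʳ w))

  +-mono-≤ : ∀ {x y u v} → x ≤ y → u ≤ v → x + u ≤ y + v
  +-mono-≤ {x} {y} {u} {v} x≤y u≤v = ≤-trans (+-monoˡ-≤ u x≤y)
    (≤-trans (≤-reflexive (+-comm y u))
    (≤-trans (+-monoˡ-≤ y u≤v) (≤-reflexive (+-comm v y))))

  +-nonNeg : ∀ {x y} → 0# ≤ x → 0# ≤ y → 0# ≤ x + y
  +-nonNeg 0≤x 0≤y = ≤-trans (≤-reflexive (sym (+-identityˡ 0#))) (+-mono-≤ 0≤x 0≤y)

  x≤x+y : ∀ {x y} → 0# ≤ y → x ≤ x + y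
  x≤x+y {x} 0≤y = ≤-trans (≤-reflexive (sym (+-identityʳ x))) (+-mono-≤ (≤-reflexive refl) 0≤y)

  x≤y+x : ∀ {x y} → 0# ≤ y → x ≤ y + x
  x≤y+x {x} 0≤y = ≤-trans (≤-reflexive (sym (+-identityˡ x))) (+-monoˡ-≤ x 0≤y)

  -- Signs are not decided. Suppose `x * y < 0#`. If `0# < x`, then `*-pos` excludes `0# < y`, so
  -- `y ≈ 0#` and the product is zero, which is absurd. Hence `x ≤ 0#`, so `x ≈ 0#` and the product
  -- is again zero.
  *-nonNeg : ∀ {x y} → 0# ≤ x → 0# ≤ y → 0# ≤ x * y
  *-nonNeg {x} {y} 0≤x 0≤y xy<0 = irrefl xy≈0 xy<0
    where
    x≤0 : x ≤ 0#
    x≤0 0<x = irrefl (trans (*-congˡ (≤-antisym y≤0 0≤y)) (zeroʳ x)) xy<0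
      where
      y≤0 : y ≤ 0#
      y≤0 0<y = asym xy<0 (*-pos 0<x 0<y)

    xy≈0 : x * y ≈ 0#
    xy≈0 = trans (*-congʳ (≤-antisym x≤0 0≤x)) (zeroˡ y)

  -- If `1# < 0#`, then `- 1#` is positive, and so is its square, which is `1#`.
  0≤1 : 0# ≤ 1#
  0≤1 1<0 = asym 1<0 (<-respʳ-≈ -1*-1≈1 (*-pos 0<-1 0<-1))
    where
    open CommutativeRing commutativeRing using (ring)
    open Algebra.Properties.Ring ring using (-‿distribˡ-*; -‿involutive)

    0<-1 : 0# < - 1#
    0<-1 = <-respˡ-≈ (-‿inverseʳ 1#) (<-respʳ-≈ (+-identityˡ (- 1#)) (+-monoˡ-< (- 1#) 1<0))

    -1*-1≈1 : - 1# * - 1# ≈ 1#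
    -1*-1≈1 = trans (sym (-‿distribˡ-* 1# (- 1#)))
      (trans (-‿cong (*-identityˡ (- 1#))) (-‿involutive 1#))

-- Finite sums and the first moment bound.

module FirstMoment {c ℓ₁ ℓ₂ ℓ₃} (F : OrderedField c ℓ₁ ℓ₂ ℓ₃) where
  open OrderedField F hiding (zero)
  open OrderedFieldProperties F
  open Sums F
  open CommutativeRing commutativeRing using (+-commutativeMonoid; +-commutativeSemigroup; *-commutativeSemigroup)
  open Algebra.Properties.Semiring.Sum semiring hiding (sum)
  open Algebra.Properties.Semiring.Mult semiring hiding (_×_)
  open Algebra.Properties.Semiring.Exp semiring using (^-congˡ)
  open Algebra.Properties.CommutativeMonoid.Mult +-commutativeMonoid using (×-distrib-+)
  open Algebra.Properties.CommutativeSemigroup +-commutativeSemigroup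
    using () renaming (x∙yz≈y∙xz to x+[y+z]≈y+[x+z])
  open Algebra.Properties.CommutativeSemigroup *-commutativeSemigroup
    using () renaming (x∙yz≈y∙xz to x*[y*z]≈y*[x*z])
  open Relation.Binary.Reasoning.Setoid setoid

  ×-zeroʳ : ∀ n → n × 0# ≈ 0#
  ×-zeroʳ zero    = refl
  ×-zeroʳ (suc n) = trans (+-identityˡ _) (×-zeroʳ n)

  sum-mono-≤ : ∀ {n} {f g : Vector Carrier n} → (∀ i → f i ≤ g i) → sum f ≤ sum g
  sum-mono-≤ {zero}  f≤g = ≤-reflexive refl
  sum-mono-≤ {suc n} f≤g = +-mono-≤ (f≤g zero) (sum-mono-≤ (f≤g ∘ suc))

  sum-nonNeg : ∀ {n} {f : Vector Carrier n} → (∀ i → 0# ≤ f i) → 0# ≤ sum f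
  sum-nonNeg {zero}  0≤f = ≤-reflexive refl
  sum-nonNeg {suc n} 0≤f = +-nonNeg (0≤f zero) (sum-nonNeg (0≤f ∘ suc))

  term≤sum : ∀ {n} {f : Vector Carrier n} → (∀ i → 0# ≤ f i) → ∀ i → f i ≤ sum f
  term≤sum 0≤f zero    = x≤x+y (sum-nonNeg (0≤f ∘ suc))
  term≤sum 0≤f (suc i) = ≤-trans (term≤sum (0≤f ∘ suc) i) (x≤y+x (0≤f zero))

  module _ {a} {A : Set a} where

    listSum : (A → Carrier) → List A → Carrier
    listSum f xs = foldr _+_ 0# (map f xs)

    listSum-++ : ∀ f xs ys → listSum f (xs ++ ys) ≈ listSum f xs + listSum f ys
    listSum-++ f []       ys = sym (+-identityˡ _)
    listSum-++ f (x ∷ xs) ys = trans (+-congˡ (listSum-++ f xs ys)) (sym (+-assoc _ _ _))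

    listSum-cong : ∀ {f g} → (∀ x → f x ≈ g x) → ∀ xs → listSum f xs ≈ listSum g xs
    listSum-cong f≈g []       = refl
    listSum-cong f≈g (x ∷ xs) = +-cong (f≈g x) (listSum-cong f≈g xs)

    *-distribˡ-listSum : ∀ z f xs → z * listSum f xs ≈ listSum (λ x → z * f x) xs
    *-distribˡ-listSum z f []       = zeroʳ z
    *-distribˡ-listSum z f (x ∷ xs) = trans (distribˡ z _ _) (+-congˡ (*-distribˡ-listSum z f xs))

    -- Equality is asked of members alone because the summands later depend on `∣ S ∣`, which is
    -- known only for `S` in `subsetsOfSize`.
    listSum-const : ∀ {f z} xs → (∀ {x} → x ∈ᴸ xs → f x ≈ z) → listSum f xs ≈ length xs × z
    listSum-const []       f≈z = refl
    listSum-const (x ∷ xs) f≈z = +-cong (f≈z (here ≡.refl)) (listSum-const xs (f≈z ∘ there))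

    listSum-nonNeg : ∀ {f} → (∀ x → 0# ≤ f x) → ∀ xs → 0# ≤ listSum f xs
    listSum-nonNeg 0≤f []       = ≤-reflexive refl
    listSum-nonNeg 0≤f (x ∷ xs) = +-nonNeg (0≤f x) (listSum-nonNeg 0≤f xs)

    term≤listSum : ∀ {f x xs} → (∀ x → 0# ≤ f x) → x ∈ᴸ xs → f x ≤ listSum f xs
    term≤listSum {xs = _ ∷ xs} 0≤f (here ≡.refl) = x≤x+y (listSum-nonNeg 0≤f xs)
    term≤listSum {xs = y ∷ _}  0≤f (there x∈xs) = ≤-trans (term≤listSum 0≤f x∈xs) (x≤y+x (0≤f y))

  listSum-map : ∀ {a b} {A : Set a} {B : Set b} (f : B → Carrier) (g : A → B) xs →
                listSum f (map g xs) ≡ listSum (f ∘ g) xs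
  listSum-map f g []       = ≡.refl
  listSum-map f g (x ∷ xs) = ≡.cong (f (g x) +_) (listSum-map f g xs)

  -- Elementary symmetric polynomials

  subsetProductSum-zero : ∀ {k} (q : Vector Carrier k) → subsetProductSum 0 q ≈ 1#
  subsetProductSum-zero {zero}  q = +-identityʳ 1#
  subsetProductSum-zero {suc k} q = begin
    subsetProductSum 0 q
      ≡⟨ ≡.cong (listSum (subsetProduct q)) (subsetsOfSize-zero k) ⟩
    listSum (subsetProduct q) (map (outside Vec.∷_) (subsetsOfSize k 0))
      ≡⟨ listSum-map _ _ (subsetsOfSize k 0) ⟩
    listSum (λ S → 1# * subsetProduct (tail q) S) (subsetsOfSize k 0)
      ≈⟨ listSum-cong (λ S → *-identityˡ (subsetProduct (tail q) S)) (subsetsOfSize k 0) ⟩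
    subsetProductSum 0 (tail q)
      ≈⟨ subsetProductSum-zero (tail q) ⟩
    1# ∎

  -- Subsets are split by whether they contain the first index. This recursion carries the inductive
  -- proof of Euler's identity below.
  subsetProductSum-suc : ∀ {k} r (q : Vector Carrier (suc k)) →
    subsetProductSum (suc r) q ≈
    subsetProductSum (suc r) (tail q) + head q * subsetProductSum r (tail q)
  subsetProductSum-suc {k} r q = begin
    subsetProductSum (suc r) q
      ≡⟨ ≡.cong (listSum (subsetProduct q)) (subsetsOfSize-suc k r) ⟩
    listSum (subsetProduct q) (map (outside Vec.∷_) (subsetsOfSize k (suc r)) ++
                               map (inside Vec.∷_) (subsetsOfSize k r))
      ≈⟨ listSum-++ (subsetProduct q) (map (outside Vec.∷_) (subsetsOfSize k (suc r))) _ ⟩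
    listSum (subsetProduct q) (map (outside Vec.∷_) (subsetsOfSize k (suc r))) +
    listSum (subsetProduct q) (map (inside Vec.∷_) (subsetsOfSize k r))
      ≡⟨ ≡.cong₂ _+_ (listSum-map _ _ (subsetsOfSize k (suc r))) (listSum-map _ _ (subsetsOfSize k r)) ⟩
    listSum (λ S → 1# * subsetProduct (tail q) S) (subsetsOfSize k (suc r)) +
    listSum (λ S → head q * subsetProduct (tail q) S) (subsetsOfSize k r)
      ≈⟨ +-cong (listSum-cong (λ S → *-identityˡ (subsetProduct (tail q) S)) (subsetsOfSize k (suc r)))
                (sym (*-distribˡ-listSum (head q) (subsetProduct (tail q)) (subsetsOfSize k r))) ⟩
    subsetProductSum (suc r) (tail q) + head q * subsetProductSum r (tail q) ∎

  subsetProductSum-head-zero : ∀ {k} r (q : Vector Carrier (suc k)) → head q ≈ 0# →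
                               subsetProductSum r q ≈ subsetProductSum r (tail q)
  subsetProductSum-head-zero zero    q q₀≈0 =
    trans (subsetProductSum-zero q) (sym (subsetProductSum-zero (tail q)))
  subsetProductSum-head-zero (suc r) q q₀≈0 = begin
    subsetProductSum (suc r) q
      ≈⟨ subsetProductSum-suc r q ⟩
    subsetProductSum (suc r) (tail q) + head q * subsetProductSum r (tail q)
      ≈⟨ +-congˡ (trans (*-congʳ q₀≈0) (zeroˡ _)) ⟩
    subsetProductSum (suc r) (tail q) + 0#
      ≈⟨ +-identityʳ _ ⟩
    subsetProductSum (suc r) (tail q) ∎

  infixl 6 _∖_
  -- An index is deleted by zeroing its weight, which keeps the index type `Fin k` fixed.
  _∖_ : ∀ {k} → Vector Carrier k → Fin k → Vector Carrier k
  q ∖ i = updateAt q i (const 0#)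

  -- Euler's identity: the summand at `i` collects the monomials of degree r+1 containing `q i`, so
  -- each monomial is counted once per factor. The induction on `k` separates the monomials
  -- containing `q₀`.
  sum-*-subsetProductSum-∖ : ∀ {k} r (q : Vector Carrier k) →
    sum (λ i → q i * subsetProductSum r (q ∖ i)) ≈ suc r × subsetProductSum (suc r) q
  sum-*-subsetProductSum-∖ {zero}  r q = sym (×-zeroʳ (suc r))
  sum-*-subsetProductSum-∖ {suc k} r q = begin
    q₀ * e r (q ∖ zero) + sum (λ i → t i * e r (q ∖ suc i))
      ≈⟨ +-cong (*-congˡ (subsetProductSum-head-zero r (q ∖ zero) refl)) (tail-part r) ⟩
    q₀ * e r t + (suc r × e (suc r) t + r × (q₀ * e r t))
      -- The term from index 0 joins the `r` copies already present, making `suc r` of them by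
      -- definition of `_×_`.
      ≈⟨ x+[y+z]≈y+[x+z] (q₀ * e r t) (suc r × e (suc r) t) (r × (q₀ * e r t)) ⟩
    suc r × e (suc r) t + suc r × (q₀ * e r t)
      ≈⟨ ×-distrib-+ (e (suc r) t) (q₀ * e r t) (suc r) ⟨
    suc r × (e (suc r) t + q₀ * e r t)
      ≈⟨ ×-congʳ (suc r) (subsetProductSum-suc r q) ⟨
    suc r × e (suc r) q ∎
    where
    e = subsetProductSum
    q₀ = head q
    t = tail q

    tail-part : ∀ r → sum (λ i → t i * e r (q ∖ suc i)) ≈
                      suc r × e (suc r) t + r × (q₀ * e r t)
    tail-part zero = begin
      sum (λ i → t i * e 0 (q ∖ suc i))
        ≈⟨ sum-cong-≋ (λ i → *-congˡ (trans (subsetProductSum-zero (q ∖ suc i))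
                                            (sym (subsetProductSum-zero (t ∖ i))))) ⟩
      sum (λ i → t i * e 0 (t ∖ i))
        ≈⟨ sum-*-subsetProductSum-∖ 0 t ⟩
      1 × e 1 t
        ≈⟨ +-identityʳ _ ⟨
      1 × e 1 t + 0# ∎
    -- Expanding along `q₀` leaves two sums over `t`, to which the induction hypothesis applies at
    -- `suc r` and at `r`.
    tail-part (suc r) = begin
      sum (λ i → t i * e (suc r) (q ∖ suc i))
        ≈⟨ sum-cong-≋ (λ i → trans (*-congˡ (subsetProductSum-suc r (q ∖ suc i)))
             (trans (distribˡ _ _ _) (+-congˡ (x*[y*z]≈y*[x*z] (t i) q₀ (e r (t ∖ i)))))) ⟩
      sum (λ i → t i * e (suc r) (t ∖ i) + q₀ * (t i * e r (t ∖ i)))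
        ≈⟨ ∑-distrib-+ (λ i → t i * e (suc r) (t ∖ i)) (λ i → q₀ * (t i * e r (t ∖ i))) ⟩
      sum (λ i → t i * e (suc r) (t ∖ i)) + sum (λ i → q₀ * (t i * e r (t ∖ i)))
        ≈⟨ +-cong (sum-*-subsetProductSum-∖ (suc r) t)
                  (trans (sym (*-distribˡ-sum q₀ (λ i → t i * e r (t ∖ i))))
                  (trans (*-congˡ (sum-*-subsetProductSum-∖ r t))
                         (×-comm-* (suc r) q₀ (e (suc r) t)))) ⟩
      suc (suc r) × e (suc (suc r)) t + suc r × (q₀ * e (suc r) t) ∎

  -- Sums over colourings

  vecSum : ∀ {k} m → (Vec (Fin k) m → Carrier) → Carrier
  vecSum zero    f = f Vec.[]
  vecSum (suc m) f = sum (λ i → vecSum m (λ v → f (i Vec.∷ v)))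

  module _ {k : ℕ} where

    vecSum-cong : ∀ m {f g : Vec (Fin k) m → Carrier} → (∀ v → f v ≈ g v) → vecSum m f ≈ vecSum m g
    vecSum-cong zero    f≈g = f≈g Vec.[]
    vecSum-cong (suc m) f≈g = sum-cong-≋ (λ i → vecSum-cong m (λ v → f≈g (i Vec.∷ v)))

    vecSum-mono-≤ : ∀ m {f g : Vec (Fin k) m → Carrier} → (∀ v → f v ≤ g v) → vecSum m f ≤ vecSum m g
    vecSum-mono-≤ zero    f≤g = f≤g Vec.[]
    vecSum-mono-≤ (suc m) f≤g = sum-mono-≤ (λ i → vecSum-mono-≤ m (λ v → f≤g (i Vec.∷ v)))

    vecSum-zero : ∀ m → vecSum {k} m (λ _ → 0#) ≈ 0#
    vecSum-zero zero    = refl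
    vecSum-zero (suc m) = trans (sum-cong-≋ {k} (λ _ → vecSum-zero m)) (sum-replicate-zero k)

    vecSum-+ : ∀ m (f g : Vec (Fin k) m → Carrier) →
               vecSum m (λ v → f v + g v) ≈ vecSum m f + vecSum m g
    vecSum-+ zero    f g = refl
    vecSum-+ (suc m) f g = trans (sum-cong-≋ (λ i → vecSum-+ m (f ∘ (i Vec.∷_)) (g ∘ (i Vec.∷_))))
      (∑-distrib-+ (λ i → vecSum m (f ∘ (i Vec.∷_))) (λ i → vecSum m (g ∘ (i Vec.∷_))))

    *-distribˡ-vecSum : ∀ m z (f : Vec (Fin k) m → Carrier) →
                        z * vecSum m f ≈ vecSum m (λ v → z * f v)
    *-distribˡ-vecSum zero    z f = refl
    *-distribˡ-vecSum (suc m) z f =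
      trans (*-distribˡ-sum z (λ i → vecSum m (f ∘ (i Vec.∷_))))
            (sum-cong-≋ (λ i → *-distribˡ-vecSum m z (f ∘ (i Vec.∷_))))

    vecSum-sum : ∀ m {l} (f : Vec (Fin k) m → Vector Carrier l) →
                 vecSum m (λ v → sum (f v)) ≈ sum (λ j → vecSum m (λ v → f v j))
    vecSum-sum m {zero}  f = vecSum-zero m
    vecSum-sum m {suc l} f = trans (vecSum-+ m (head ∘ f) (sum ∘ tail ∘ f))
                                   (+-congˡ (vecSum-sum m (tail ∘ f)))

    vecSum-listSum : ∀ m {a} {A : Set a} (f : Vec (Fin k) m → A → Carrier) xs →
      vecSum m (λ v → listSum (f v) xs) ≈ listSum (λ x → vecSum m (λ v → f v x)) xs
    vecSum-listSum m f []       = vecSum-zero m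
    vecSum-listSum m f (x ∷ xs) = trans (vecSum-+ m (λ v → f v x) (λ v → listSum (f v) xs))
                                        (+-congˡ (vecSum-listSum m f xs))

  -- Used with `x = p c` to isolate the event that given edges all have colour `c`.
  only : ∀ {k} → Fin k → Carrier → Vector Carrier k
  only c x = updateAt (const 0#) c (const x)

  sum-only : ∀ {k} (c : Fin k) x → sum (only c x) ≈ x
  sum-only {suc k} zero    x = trans (+-congˡ (sum-replicate-zero k)) (+-identityʳ x)
  sum-only {suc k} (suc c) x = trans (+-identityˡ _) (sum-only c x)

  updateAt-nonNeg : ∀ {k} {q : Vector Carrier k} {x} → (∀ i → 0# ≤ q i) → 0# ≤ x →
                    ∀ c i → 0# ≤ updateAt q c (const x) i
  updateAt-nonNeg 0≤q 0≤x zero    zero    = 0≤x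
  updateAt-nonNeg 0≤q 0≤x zero    (suc i) = 0≤q (suc i)
  updateAt-nonNeg 0≤q 0≤x (suc c) zero    = 0≤q zero
  updateAt-nonNeg 0≤q 0≤x (suc c) (suc i) = updateAt-nonNeg (0≤q ∘ suc) 0≤x c i

  -- Independent random colouring of the edges.

  module _ {k} (p : Vector Carrier k) (0≤p : ∀ i → 0# ≤ p i) (∑p≈1 : sum p ≈ 1#) where

    -- An edge on which the event does not depend sums out, because the colour probabilities add up
    -- to one.
    vecSum-average : ∀ m {f : Vec (Fin k) m → Carrier} {x} → vecSum m f ≈ x →
                     sum (λ i → vecSum m (λ v → p i * f v)) ≈ x
    vecSum-average m {f} {x} ∑f≈x = begin
      sum (λ i → vecSum m (λ v → p i * f v))  ≈⟨ sum-cong-≋ (λ i → *-distribˡ-vecSum m (p i) f) ⟨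
      sum (λ i → p i * vecSum m f)            ≈⟨ *-distribʳ-sum (vecSum m f) p ⟨
      sum p * vecSum m f                      ≈⟨ *-cong ∑p≈1 ∑f≈x ⟩
      1# * x                                  ≈⟨ *-identityˡ x ⟩
      x                                       ∎

    -- The probability of the colouring `v`.
    weight : ∀ {m} → Vec (Fin k) m → Carrier
    weight v = product (λ j → p (lookup v j))

    vecSum-weight : ∀ m → vecSum m weight ≈ 1#
    vecSum-weight zero    = refl
    vecSum-weight (suc m) = vecSum-average m (vecSum-weight m)

    -- For `q = only c (p c)` this is the probability of `v` if `v` has colour `c` throughout `D`,
    -- and zero otherwise.
    weightOn : ∀ {m} → Vector Carrier k → Subset m → Vec (Fin k) m → Carrier
    weightOn q Vec.[]            Vec.[]      = 1#
    weightOn q (outside Vec.∷ D) (i Vec.∷ v) = p i * weightOn q D v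
    weightOn q (inside  Vec.∷ D) (i Vec.∷ v) = q i * weightOn q D v

    -- Zeroing the weight of each colour once it is used on D makes this
    -- vanish unless v is injective on D.
    rainbowWeight : ∀ {m} → Vector Carrier k → Subset m → Vec (Fin k) m → Carrier
    rainbowWeight q Vec.[]            Vec.[]      = 1#
    rainbowWeight q (outside Vec.∷ D) (i Vec.∷ v) = p i * rainbowWeight q D v
    rainbowWeight q (inside  Vec.∷ D) (i Vec.∷ v) = q i * rainbowWeight (q ∖ i) D v

    weightOn-nonNeg : ∀ {m q} → (∀ i → 0# ≤ q i) → ∀ (D : Subset m) v → 0# ≤ weightOn q D v
    weightOn-nonNeg 0≤q Vec.[]            Vec.[]      = 0≤1
    weightOn-nonNeg 0≤q (outside Vec.∷ D) (i Vec.∷ v) = *-nonNeg (0≤p i) (weightOn-nonNeg 0≤q D v)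
    weightOn-nonNeg 0≤q (inside  Vec.∷ D) (i Vec.∷ v) = *-nonNeg (0≤q i) (weightOn-nonNeg 0≤q D v)

    rainbowWeight-nonNeg : ∀ {m q} → (∀ i → 0# ≤ q i) → ∀ (D : Subset m) v → 0# ≤ rainbowWeight q D v
    rainbowWeight-nonNeg 0≤q Vec.[]            Vec.[]      = 0≤1
    rainbowWeight-nonNeg 0≤q (outside Vec.∷ D) (i Vec.∷ v) = *-nonNeg (0≤p i) (rainbowWeight-nonNeg 0≤q D v)
    rainbowWeight-nonNeg 0≤q (inside  Vec.∷ D) (i Vec.∷ v) =
      *-nonNeg (0≤q i) (rainbowWeight-nonNeg (updateAt-nonNeg 0≤q (≤-reflexive refl) i) D v)

    weightOn≡weight : ∀ {m q} (D : Subset m) v → (∀ j → j ∈ D → q (lookup v j) ≡ p (lookup v j)) →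
                      weightOn q D v ≡ weight v
    weightOn≡weight Vec.[]            Vec.[]      q≗p = ≡.refl
    weightOn≡weight (outside Vec.∷ D) (i Vec.∷ v) q≗p =
      ≡.cong (p i *_) (weightOn≡weight D v (λ j → q≗p (suc j) ∘ Vec.there))
    weightOn≡weight (inside  Vec.∷ D) (i Vec.∷ v) q≗p =
      ≡.cong₂ _*_ (q≗p zero Vec.here) (weightOn≡weight D v (λ j → q≗p (suc j) ∘ Vec.there))

    -- By injectivity the colour of the first edge in `D` does not recur on later edges of `D`, so
    -- zeroing it preserves the agreement of `q` with `p` there.
    rainbowWeight≡weight : ∀ {m q} (D : Subset m) v → InjectiveOn v D →
                           (∀ j → j ∈ D → q (lookup v j) ≡ p (lookup v j)) →
                           rainbowWeight q D v ≡ weight v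
    rainbowWeight≡weight Vec.[]            Vec.[]      inj q≗p = ≡.refl
    rainbowWeight≡weight (outside Vec.∷ D) (i Vec.∷ v) inj q≗p =
      ≡.cong (p i *_) (rainbowWeight≡weight D v
        (λ j j′ j∈ j′∈ j≢j′ → inj (suc j) (suc j′) (Vec.there j∈) (Vec.there j′∈) (λ { ≡.refl → j≢j′ ≡.refl }))
        (λ j → q≗p (suc j) ∘ Vec.there))
    rainbowWeight≡weight {q = q} (inside Vec.∷ D) (i Vec.∷ v) inj q≗p =
      ≡.cong₂ _*_ (q≗p zero Vec.here) (rainbowWeight≡weight D v
        (λ j j′ j∈ j′∈ j≢j′ → inj (suc j) (suc j′) (Vec.there j∈) (Vec.there j′∈) (λ { ≡.refl → j≢j′ ≡.refl }))
        (λ j j∈ → ≡.trans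
          (updateAt-minimal (lookup v j) i q (inj (suc j) zero (Vec.there j∈) Vec.here λ ()))
          (q≗p (suc j) (Vec.there j∈))))

    -- By independence, each edge in `D` gives a factor `sum q` and each other edge a factor one.
    vecSum-weightOn : ∀ {m} q (D : Subset m) → vecSum m (weightOn q D) ≈ sum q ^ ∣ D ∣
    vecSum-weightOn q Vec.[]            = refl
    vecSum-weightOn {suc m} q (outside Vec.∷ D) = vecSum-average m (vecSum-weightOn q D)
    vecSum-weightOn {suc m} q (inside  Vec.∷ D) = begin
      sum (λ i → vecSum m (λ v → q i * weightOn q D v))
        ≈⟨ sum-cong-≋ (λ i → trans (sym (*-distribˡ-vecSum m (q i) (weightOn q D)))
                                   (*-congˡ (vecSum-weightOn q D))) ⟩
      sum (λ i → q i * sum q ^ ∣ D ∣)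
        ≈⟨ *-distribʳ-sum (sum q ^ ∣ D ∣) q ⟨
      sum q * sum q ^ ∣ D ∣ ∎

    -- The vector `q` is arbitrary because an edge of `D` that takes colour `i` passes `q ∖ i` on to
    -- the edges after it.
    vecSum-rainbowWeight : ∀ {m} q (D : Subset m) →
      vecSum m (rainbowWeight q D) ≈ (∣ D ∣ !) × subsetProductSum ∣ D ∣ q
    vecSum-rainbowWeight q Vec.[] = sym (trans (+-identityʳ _) (subsetProductSum-zero q))
    vecSum-rainbowWeight {suc m} q (outside Vec.∷ D) = vecSum-average m (vecSum-rainbowWeight q D)
    vecSum-rainbowWeight {suc m} q (inside  Vec.∷ D) = begin
      sum (λ i → vecSum m (λ v → q i * rainbowWeight (q ∖ i) D v))
        ≈⟨ sum-cong-≋ (λ i → *-distribˡ-vecSum m (q i) (rainbowWeight (q ∖ i) D)) ⟨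
      sum (λ i → q i * vecSum m (rainbowWeight (q ∖ i) D))
        ≈⟨ sum-cong-≋ (λ i → trans (*-congˡ (vecSum-rainbowWeight (q ∖ i) D))
             (×-comm-* (r !) (q i) (subsetProductSum r (q ∖ i)))) ⟩
      sum (λ i → (r !) × (q i * subsetProductSum r (q ∖ i)))
        ≈⟨ ×-sum (r !) (λ i → q i * subsetProductSum r (q ∖ i)) ⟨
      (r !) × sum (λ i → q i * subsetProductSum r (q ∖ i))
        -- Euler's identity supplies the factor `suc r` that turns `r !` into `suc r !`.
        ≈⟨ ×-congʳ (r !) (sum-*-subsetProductSum-∖ r q) ⟩
      (r !) × suc r × subsetProductSum (suc r) q
        ≈⟨ ×-assocˡ _ (r !) (suc r) ⟩
      (r ! ℕ.* suc r) × subsetProductSum (suc r) q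
        ≡⟨ ≡.cong (_× subsetProductSum (suc r) q) (ℕₚ.*-comm (r !) (suc r)) ⟩
      (suc r !) × subsetProductSum (suc r) q ∎
      where
      r = ∣ D ∣
      ×-sum : ∀ n {l} (f : Vector Carrier l) → n × sum f ≈ sum (λ i → n × f i)
      ×-sum n {zero}  f = ×-zeroʳ n
      ×-sum n {suc l} f = trans (×-distrib-+ (head f) (sum (tail f)) n) (+-congˡ (×-sum n (tail f)))

    -- Union bound over the copies of the two complete graphs.

    module _ (n s t : ℕ) (k>0 : k ℕ.> 0) where

      rainbowTerm : Vec (Fin k) (edgeCount n) → Subset n → Carrier
      rainbowTerm v S = rainbowWeight p (edgesWithin S) v

      monoTerm : Vec (Fin k) (edgeCount n) → Subset n → Vector Carrier k
      monoTerm v S c = weightOn (only c (p c)) (edgesWithin S) v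

      badWeight : Vec (Fin k) (edgeCount n) → Carrier
      badWeight v = listSum (rainbowTerm v) (subsetsOfSize n s) +
                    listSum (sum ∘ monoTerm v) (subsetsOfSize n t)

      rainbowTerm-nonNeg : ∀ v S → 0# ≤ rainbowTerm v S
      rainbowTerm-nonNeg v S = rainbowWeight-nonNeg 0≤p (edgesWithin S) v

      monoTerm-nonNeg : ∀ v S c → 0# ≤ monoTerm v S c
      monoTerm-nonNeg v S c = weightOn-nonNeg
        (updateAt-nonNeg (λ _ → ≤-reflexive refl) (0≤p c) c) (edgesWithin S) v

      -- The copy that must exist contributes a term equal to `weight v`, and the other terms are
      -- nonnegative.
      weight≤badWeight : Unavoidable k s t n → ∀ v → weight v ≤ badWeight v
      weight≤badWeight unavoidable v with unavoidable (colouring n v)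
      ... | inj₁ (S , size , rainbow) = ≤-trans
        (≤-reflexive (reflexive (≡.sym (rainbowWeight≡weight (edgesWithin S) v
          (rainbow⇒injectiveOn v S rainbow) (λ _ _ → ≡.refl)))))
        (≤-trans (term≤listSum (rainbowTerm-nonNeg v) (∈-subsetsOfSize S size))
          (x≤x+y (listSum-nonNeg (λ S → sum-nonNeg (monoTerm-nonNeg v S)) (subsetsOfSize n t))))
      ... | inj₂ (S , size , mono) = let c , v≡c = monochromatic⇒constantOn k>0 v S mono in ≤-trans
        -- Every edge within `S` has colour `c`, where `only c (p c)` agrees with `p`.
        (≤-reflexive (reflexive (≡.sym (weightOn≡weight (edgesWithin S) v (λ j j∈ →
          ≡.subst (λ d → only c (p c) d ≡ p d) (≡.sym (v≡c j j∈)) (updateAt-updates c (const 0#)))))))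
        (≤-trans (term≤sum (monoTerm-nonNeg v S) c)
        (≤-trans (term≤listSum (λ S → sum-nonNeg (monoTerm-nonNeg v S)) (∈-subsetsOfSize S size))
          (x≤y+x (listSum-nonNeg (rainbowTerm-nonNeg v) (subsetsOfSize n s)))))

      -- Linearity of expectation. Copies of one size contribute equally, since `∣ edgesWithin S ∣`
      -- depends only on `∣ S ∣`.
      vecSum-badWeight : vecSum (edgeCount n) badWeight ≈
        (n C s) × ((s ℕ.* (s ℕ.∸ 1) / 2) !) × subsetProductSum (s C 2) p
          + (n C t) × sum (λ i → p i ^ (t C 2))
      vecSum-badWeight = trans (vecSum-+ m (λ v → listSum (rainbowTerm v) (subsetsOfSize n s))
                                           (λ v → listSum (sum ∘ monoTerm v) (subsetsOfSize n t)))
                               (+-cong rainbow-part mono-part)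
        where
        m = edgeCount n

        ∣edges∣ : ∀ {r S} → S ∈ᴸ subsetsOfSize n r → ∣ edgesWithin S ∣ ≡ r C 2
        ∣edges∣ {r} {S} S∈ = ≡.trans (∣edgesWithin∣ S) (≡.cong (_C 2) (∈-subsetsOfSize⁻ S∈))

        rainbow-part : vecSum m (λ v → listSum (rainbowTerm v) (subsetsOfSize n s)) ≈
          (n C s) × ((s ℕ.* (s ℕ.∸ 1) / 2) !) × subsetProductSum (s C 2) p
        rainbow-part = begin
          vecSum m (λ v → listSum (rainbowTerm v) (subsetsOfSize n s))
            ≈⟨ vecSum-listSum m rainbowTerm (subsetsOfSize n s) ⟩
          listSum (λ S → vecSum m (rainbowWeight p (edgesWithin S))) (subsetsOfSize n s)
            ≈⟨ listSum-const (subsetsOfSize n s) (λ {S} S∈ → trans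
                 (vecSum-rainbowWeight p (edgesWithin S))
                 (reflexive (≡.cong (λ r → (r !) × subsetProductSum r p) (∣edges∣ S∈)))) ⟩
          length (subsetsOfSize n s) × ((s C 2) !) × subsetProductSum (s C 2) p
            -- Only the factorial changes to the quotient form; the index of `subsetProductSum`
            -- stays `s C 2`.
            ≡⟨ ≡.cong₂ (λ a b → a × (b !) × subsetProductSum (s C 2) p)
                 (length-subsetsOfSize n s) (≡.sym (n*[n∸1]/2≡nC2 s)) ⟩
          (n C s) × ((s ℕ.* (s ℕ.∸ 1) / 2) !) × subsetProductSum (s C 2) p ∎

        mono-part : vecSum m (λ v → listSum (sum ∘ monoTerm v) (subsetsOfSize n t)) ≈
                    (n C t) × sum (λ i → p i ^ (t C 2))
        mono-part = begin
          vecSum m (λ v → listSum (sum ∘ monoTerm v) (subsetsOfSize n t))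
            ≈⟨ vecSum-listSum m (λ v → sum ∘ monoTerm v) (subsetsOfSize n t) ⟩
          listSum (λ S → vecSum m (λ v → sum (monoTerm v S))) (subsetsOfSize n t)
            ≈⟨ listSum-const (subsetsOfSize n t) (λ {S} S∈ → trans
                 (vecSum-sum m (λ v → monoTerm v S))
                 (sum-cong-≋ (λ c → trans (vecSum-weightOn (only c (p c)) (edgesWithin S))
                   (trans (^-congˡ ∣ edgesWithin S ∣ (sum-only c (p c)))
                          (reflexive (≡.cong (p c ^_) (∣edges∣ S∈))))))) ⟩
          length (subsetsOfSize n t) × sum (λ i → p i ^ (t C 2))
            ≡⟨ ≡.cong (_× sum (λ i → p i ^ (t C 2))) (length-subsetsOfSize n t) ⟩
          (n C t) × sum (λ i → p i ^ (t C 2)) ∎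

      -- The left side is the total probability, compared with `badWeight` colouring by colouring.
      1≤firstMoment : Unavoidable k s t n →
        1# ≤ (n C s) × ((s ℕ.* (s ℕ.∸ 1) / 2) !) × subsetProductSum (s C 2) p
               + (n C t) × sum (λ i → p i ^ (t C 2))
      1≤firstMoment unavoidable = ≤-trans (≤-reflexive (sym (vecSum-weight (edgeCount n))))
        (≤-trans (vecSum-mono-≤ (edgeCount n) (weight≤badWeight unavoidable))
                 (≤-reflexive vecSum-badWeight))

theorem3p2 : ∀ {c ℓ₁ ℓ₂ ℓ₃} (F : OrderedField c ℓ₁ ℓ₂ ℓ₃) →
    let open OrderedField F
        open Sums F in
    (n s t k : ℕ) →
    n ℕ.> 0 → s ℕ.> 0 → t ℕ.> 0 → k ℕ.> 0 →
    k ℕ.≥ s C 2 →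
    (p : Fin k → Carrier) →
    (∀ i → 0# ≤ p i) → (∀ i → p i ≤ 1#) →
    -- p is a probability distribution on the colours; for p = 0 the
    -- claim would fail, e.g. at n = s = t = 2, k = 1
    sum p ≈ 1# →
    (n C s) × ((s ℕ.* (s ℕ.∸ 1) / 2) !) × subsetProductSum (s C 2) p
      + (n C t) × sum (λ i → p i ^ (t C 2))
      < 1# →
    ∀ g → IsGallaiRamseyNumber k s t g → g ℕ.> n
theorem3p2 F n s t k _ _ _ k>0 _ p 0≤p _ ∑p≈1 bound<1 g isGR =
  -- If `g ≤ n`, unavoidability lifts from `g` to `n`. The resulting `1# ≤ ...` is by definition the
  -- negation of `bound<1`.
  ℕₚ.≰⇒> λ g≤n → FirstMoment.1≤firstMoment F p 0≤p ∑p≈1 n s t k>0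
    (Unavoidable-mono {s = s} {t} (ℕₚ.≤⇒≤′ g≤n) (IsGallaiRamseyNumber.unavoidable isGR))
    bound<1
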